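{- Let $\bigcirc$ be a modality on a universe $\mathcal U$ and let $A$ be a type in $\mathcal U$. The wild category $(A/\mathcal U)_{\bigcirc}$ of modal $A$-types has all colimits: for every graph $\Gamma$ and every $\Gamma$-shaped diagram $F$ in $(A/\mathcal U)_{\bigcirc}$ there is a colimiting cocone under $F$.
   Context: Everything is inside Book HoTT (univalent universes, pushout types); $p\cdot q$ is path concatenation, $\mathsf{ap}_f$ the action of $f$ on paths. Modality: functions $\bigcirc:\mathcal U\to\mathcal U$ and $\eta:\prod_{X:\mathcal U}X\to\bigcirc X$, where $X$ is called modal if $\eta_X$ is an equivalence and $\mathcal U_{\bigcirc}$ is the subuniverse of modal types, such that: (i) each $\bigcirc X$ is modal; (ii) for all $X$ and $x,y:\bigcirc X$ the type $x=y$ is modal; (iii) for all $X$ and $P:\bigcirc X\to\mathcal U_{\bigcirc}$ the map $-\circ\eta_X:(\prod_{x:\bigcirc X}P(x))\to\prod_{x:X}P(\eta_X(x))$ has a section. A wild category consists of objects, hom types (not assumed sets), identities, composition $\circ$, unit laws (paths) and an associativity law $\mathsf{assoc}(f,g,h):(f\circ g)\circ h=f\circ(g\circ h)$, with no further coherence. $A/\mathcal U$ is the wild category with objects pairs $(X,s)$, $X:\mathcal U$, $s:A\to X$; morphisms $(X,s)\to_A(Y,t)$ are pairs $(k,p)$ with $k:X\to Y$ and $p:k\circ s\sim t$; composition is $(g,q)\circ(f,p)=(g\circ f,\ \lambda a.\,\mathsf{ap}_g(p(a))\cdot q(a))$, with evident identities, unit and associativity laws. $(A/\mathcal U)_{\bigcirc}$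 is the full wild subcategory on those $(X,s)$ with $X$ modal. Graph $\Gamma$: a type $\Gamma_0:\mathcal U$ of vertices and a family $\Gamma_1:\Gamma_0\to\Gamma_0\to\mathcal U$ of edges. Diagram $F$: objects $F_i$ and morphisms $F_{i,j,g}:\mathsf{hom}(F_i,F_j)$ for $g:\Gamma_1(i,j)$. Cocone $(C,r,K)$ under $F$: an object $C$, $r_i:\mathsf{hom}(F_i,C)$, paths $K_{i,j,g}:r_j\circ F_{i,j,g}=r_i$. It is colimiting if for every object $X$ the map $\mathsf{hom}(C,X)\to\sum_{s:\prod_i\mathsf{hom}(F_i,X)}\prod_{i,j,g}s_j\circ F_{i,j,g}=s_i$, $f\mapsto(\lambda i.f\circ r_i,\ \mathsf{assoc}(f,r_j,F_{i,j,g})\cdot\mathsf{ap}_{f\circ- }(K_{i,j,g}))$ is an equivalence. -}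

{-# OPTIONS --without-K #-}

module Defs where

open import Level using (Level; _⊔_) renaming (suc to lsuc)
open import Data.Product using (Σ; Σ-syntax; _×_; _,_; proj₁; proj₂)
open import Function.Base using (id; _∘_)
open import Relation.Binary.PropositionalEquality using (_≡_; refl; sym; trans; cong; cong-app; dcong; subst)

-- Identity types are _≡_ without axiom K, so types need not be sets; path
-- concatenation p · q is trans p q, and ap is cong.

private
  variable
    a b o h γ : Level

record IsEquiv {X : Set a} {Y : Set b} (f : X → Y) : Set (a ⊔ b) where
  field
    inv     : Y → X
    unit    : ∀ x → inv (f x) ≡ x
    counit  : ∀ y → f (inv y) ≡ y
    adjoint : ∀ x → cong f (unit x) ≡ counit (f x)

HasSection : {X : Set a} {Y : Set b} → (X → Y) → Set (a ⊔ b)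
HasSection {X = X} {Y = Y} f = Σ[ s ∈ (Y → X) ] (∀ y → f (s y) ≡ y)

-- The setting is Book HoTT with 𝒰 = Set ℓ.  Agda provides neither function
-- extensionality nor higher inductive types, so funext and pushouts are
-- hypotheses.  Univalence enters none of the definitions below, and is not
-- assumed.

-- Function extensionality in the strong form: cong-app (the map happly taking
-- paths of functions to homotopies) is an equivalence.  A bare map from
-- homotopies to paths would not do: it could send λ x → refl to a nontrivial
-- loop, and the associativity paths of the coslice below depend on it.
FunExt : (ℓ : Level) → Set (lsuc ℓ)
FunExt ℓ = {X : Set ℓ} {Y : X → Set ℓ} (f g : (x : X) → Y x) →
           IsEquiv (cong-app {f = f} {g = g})

funext : ∀ {ℓ} → FunExt ℓ → {X : Set ℓ} {Y : X → Set ℓ} {f g : (x : X) → Y x} →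
         (∀ x → f x ≡ g x) → f ≡ g
funext fe {f = f} {g = g} = IsEquiv.inv (fe f g)

-- Pushout types with their induction principle.  The computation rules on
-- points hold judgmentally in Book HoTT; here they are paths (which asks for
-- less), and the rule on glue is corrected by them.
record PushoutOf {ℓ} {X Y Z : Set ℓ} (f : Z → X) (g : Z → Y) : Set (lsuc ℓ) where
  field
    Pushout : Set ℓ
    inl     : X → Pushout
    inr     : Y → Pushout
    glue    : ∀ z → inl (f z) ≡ inr (g z)

  MethodsFor : (Pushout → Set ℓ) → Set ℓ
  MethodsFor P = Σ[ l ∈ (∀ x → P (inl x)) ] Σ[ r ∈ (∀ y → P (inr y)) ]
                   (∀ z → subst P (glue z) (l (f z)) ≡ r (g z))

  field
    elim      : (P : Pushout → Set ℓ) → MethodsFor P → ∀ w → P w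
    elim-inl  : ∀ P ((l , r , m) : MethodsFor P) x → elim P (l , r , m) (inl x) ≡ l x
    elim-inr  : ∀ P ((l , r , m) : MethodsFor P) y → elim P (l , r , m) (inr y) ≡ r y
    elim-glue : ∀ P ((l , r , m) : MethodsFor P) z →
      trans (dcong (elim P (l , r , m)) (glue z)) (elim-inr P (l , r , m) (g z)) ≡
      trans (cong (subst P (glue z)) (elim-inl P (l , r , m) (f z))) (m z)

Pushouts : (ℓ : Level) → Set (lsuc ℓ)
Pushouts ℓ = {X Y Z : Set ℓ} (f : Z → X) (g : Z → Y) → PushoutOf f g

record Modality (ℓ : Level) : Set (lsuc ℓ) where
  field
    ○ : Set ℓ → Set ℓ
    η : (X : Set ℓ) → X → ○ X

  IsModal : Set ℓ → Set ℓ
  IsModal X = IsEquiv (η X)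

  𝒰○ : Set (lsuc ℓ)
  𝒰○ = Σ[ X ∈ Set ℓ ] IsModal X

  field
    ○-modal  : ∀ X → IsModal (○ X)
    ≡-modal  : ∀ X (x y : ○ X) → IsModal (x ≡ y)
    ∘η-split : ∀ X (P : ○ X → 𝒰○) →
               HasSection (λ (k : ∀ x → proj₁ (P x)) (x : X) → k (η X x))

record WildCategory (o h : Level) : Set (lsuc (o ⊔ h)) where
  infixr 9 _⊚_
  field
    Ob    : Set o
    hom   : Ob → Ob → Set h
    ident : ∀ {X} → hom X X
    _⊚_   : ∀ {X Y Z} → hom Y Z → hom X Y → hom X Z
    unitˡ : ∀ {X Y} (f : hom X Y) → ident ⊚ f ≡ f
    unitʳ : ∀ {X Y} (f : hom X Y) → f ⊚ ident ≡ f
    assoc : ∀ {W X Y Z} (f : hom Y Z) (g : hom X Y) (k : hom W X) →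
            (f ⊚ g) ⊚ k ≡ f ⊚ (g ⊚ k)

FullSubcategory : ∀ {p} (C : WildCategory o h) → (WildCategory.Ob C → Set p) →
                  WildCategory (o ⊔ p) h
FullSubcategory C P = record
  { Ob    = Σ Ob P
  ; hom   = λ X Y → hom (proj₁ X) (proj₁ Y)
  ; ident = ident
  ; _⊚_   = _⊚_
  ; unitˡ = unitˡ
  ; unitʳ = unitʳ
  ; assoc = assoc
  }
  where open WildCategory C

module _ {ℓ} (fe : FunExt ℓ) (A : Set ℓ) where

  CosliceOb : Set (lsuc ℓ)
  CosliceOb = Σ[ X ∈ Set ℓ ] (A → X)

  CosliceHom : CosliceOb → CosliceOb → Set ℓ
  CosliceHom (X , s) (Y , t) = Σ[ k ∈ (X → Y) ] (∀ x → k (s x) ≡ t x)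

  private
    hom-path : ∀ {S T : CosliceOb} {k : proj₁ S → proj₁ T}
               {p q : ∀ x → k (proj₂ S x) ≡ proj₂ T x} →
               (∀ x → p x ≡ q x) → _≡_ {A = CosliceHom S T} (k , p) (k , q)
    hom-path {k = k} e = cong (k ,_) (funext fe e)

    idˡ : {X : Set ℓ} {x y : X} (p : x ≡ y) → trans (cong id p) refl ≡ p
    idˡ refl = refl

    idʳ : {X Y : Set ℓ} (f : X → Y) {x : X} {y : Y} (p : f x ≡ y) →
          trans (cong f refl) p ≡ p
    idʳ f p = refl

    assoc-path : {X Y Z : Set ℓ} (f : Y → Z) (g : X → Y)
                 {x x′ : X} {y : Y} {z : Z}
                 (p : x ≡ x′) (q : g x′ ≡ y) (r : f y ≡ z) →
                 trans (cong (f ∘ g) p) (trans (cong f q) r) ≡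
                 trans (cong f (trans (cong g p) q)) r
    assoc-path f g refl q r = refl

  Coslice : WildCategory (lsuc ℓ) ℓ
  Coslice = record
    { Ob    = CosliceOb
    ; hom   = CosliceHom
    ; ident = id , λ _ → refl
    ; _⊚_   = λ { (g , q) (f , p) → g ∘ f , λ x → trans (cong g (p x)) (q x) }
    ; unitˡ = λ { (f , p) → hom-path (λ x → idˡ (p x)) }
    ; unitʳ = λ { (f , p) → hom-path (λ x → idʳ f (p x)) }
    ; assoc = λ { (f , r) (g , q) (k , p) →
                  hom-path (λ x → assoc-path f g (p x) (q x) (r x)) }
    }

  ModalCoslice : Modality ℓ → WildCategory (lsuc ℓ) ℓ
  ModalCoslice M = FullSubcategory Coslice (λ S → Modality.IsModal M (proj₁ S))

record Graph (γ : Level) : Set (lsuc γ) where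
  field
    Vertex : Set γ
    Edge   : Vertex → Vertex → Set γ

module _ (C : WildCategory o h) (Γ : Graph γ) where
  open WildCategory C
  open Graph Γ

  record Diagram : Set (o ⊔ h ⊔ γ) where
    field
      obj : Vertex → Ob
      map : ∀ {i j} → Edge i j → hom (obj i) (obj j)

module _ {C : WildCategory o h} {Γ : Graph γ} (F : Diagram C Γ) where
  open WildCategory C
  open Graph Γ
  open Diagram F

  CoconeOn : Ob → Set (h ⊔ γ)
  CoconeOn X = Σ[ s ∈ (∀ i → hom (obj i) X) ]
                 (∀ i j (g : Edge i j) → s j ⊚ map g ≡ s i)

  Cocone : Set (o ⊔ h ⊔ γ)
  Cocone = Σ Ob CoconeOn

  postcompose : (K : Cocone) (X : Ob) → hom (proj₁ K) X → CoconeOn X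
  postcompose (_ , r , K) X f =
    (λ i → f ⊚ r i) ,
    (λ i j g → trans (assoc f (r j) (map g)) (cong (f ⊚_) (K i j g)))

  IsColimiting : Cocone → Set (o ⊔ h ⊔ γ)
  IsColimiting K = ∀ X → IsEquiv (postcompose K X)

-- For a wild category with hom types in Set h, "all" colimits are those over
-- graphs in the same universe.
HasAllColimits : WildCategory o h → Set (o ⊔ lsuc h)
HasAllColimits {h = h} C =
  (Γ : Graph h) (F : Diagram C Γ) → Σ[ K ∈ Cocone F ] IsColimiting F K

{-# OPTIONS --without-K #-}
module Submission where

-- A cocone under F on a modal A-type (X , t) amounts to maps s i : F i → X, paths
-- s i (f i a) ≡ t a and s j (F g x) ≡ s i x, and for every edge g and every a a
-- 2-path relating them.  The type classifying these data is obtained from A ⊎ Σ i F i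
-- by attaching 1-cells (a pushout along N × Bool → N) and then 2-cells (a pushout
-- along N × S¹ → N), and its reflection classifies them among modal types.  Each
-- universal property is an equivalence given by an explicit map, and the composite of
-- these maps is homotopic to postcomposition with the resulting cocone.

open import Level using (Level; Lift; lift)
open import Data.Bool.Base using (Bool; true; false; if_then_else_)
open import Data.Product using (Σ; Σ-syntax; _×_; _,_; proj₁; proj₂)
open import Data.Sum.Base using (_⊎_; inj₁; inj₂)
open import Data.Unit.Polymorphic using (⊤; tt)
open import Function.Base using (id; _∘_)
open import Function.Bundles using (mk↔ₛ′)
open import Function.Properties.Inverse.HalfAdjointEquivalence using (_≃_; ↔⇒≃)
open import Relation.Binary.PropositionalEquality
  using (_≡_; refl; sym; trans; cong; cong₂; cong-app; dcong; subst; trans-reflʳ;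
         trans-assoc; trans-symˡ; trans-injectiveʳ; trans-cong; cong-∘; cong-id)
open import Defs

open IsEquiv

private
  variable
    a b c : Level
    X Y Z : Set a

-- Closure properties of equivalences.

isEquiv : (f : X → Y) (g : Y → X) →
          (∀ x → g (f x) ≡ x) → (∀ y → f (g y) ≡ y) → IsEquiv f
isEquiv f g gf fg = record
  { inv     = E.from
  ; unit    = E.left-inverse-of
  ; counit  = E.right-inverse-of
  ; adjoint = E.left-right
  }
  where module E = _≃_ (↔⇒≃ (mk↔ₛ′ f g fg gf))

IsEquiv-∘ : {g : Y → Z} {f : X → Y} → IsEquiv g → IsEquiv f → IsEquiv (g ∘ f)
IsEquiv-∘ {g = g} {f} ge fe = isEquiv _ (inv fe ∘ inv ge)
  (λ x → trans (cong (inv fe) (unit ge (f x))) (unit fe x))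
  (λ z → trans (cong g (counit fe (inv ge z))) (counit ge z))

IsEquiv-cancelˡ : {g : Y → Z} {f : X → Y} → IsEquiv g → IsEquiv (g ∘ f) → IsEquiv f
IsEquiv-cancelˡ {g = g} {f} ge gfe = isEquiv f (inv gfe ∘ g) (unit gfe)
  (λ y → trans (sym (unit ge _)) (trans (cong (inv ge) (counit gfe (g y))) (unit ge y)))

IsEquiv-resp-~ : {f g : X → Y} → (∀ x → f x ≡ g x) → IsEquiv f → IsEquiv g
IsEquiv-resp-~ {g = g} h fe = isEquiv g (inv fe)
  (λ x → trans (cong (inv fe) (sym (h x))) (unit fe x))
  (λ y → trans (sym (h _)) (counit fe y))

IsEquiv-injective : {f : X → Y} → IsEquiv f → ∀ {x y} → f x ≡ f y → x ≡ y
IsEquiv-injective e {x} {y} p = trans (sym (unit e x)) (trans (cong (inv e) p) (unit e y))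

IsEquiv-trans : {A : Set a} {w x y z : A} (p : x ≡ w) (q : y ≡ z) →
                IsEquiv (λ (e : w ≡ y) → trans p (trans e q))
IsEquiv-trans refl refl = isEquiv _ id trans-reflʳ trans-reflʳ

IsEquiv-transˡ : {A : Set a} {x y z : A} (p : x ≡ y) →
                 IsEquiv (λ (q : y ≡ z) → trans p q)
IsEquiv-transˡ refl = isEquiv _ id (λ _ → refl) (λ _ → refl)

module _ {A : Set a} {B : Set b} {f : A → B} where

  private
    subst-unit : (P : B → Set c) (e : IsEquiv f) (x : A) (p : P (f x)) →
                 (q : f (inv e (f x)) ≡ f x) → cong f (unit e x) ≡ q →
                 _≡_ {A = Σ A (P ∘ f)} (inv e (f x) , subst P (sym q) p) (x , p)
    subst-unit P e x p q refl = go (unit e x)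
      where
      go : ∀ {x′} (u : x′ ≡ x) →
           _≡_ {A = Σ A (P ∘ f)} (x′ , subst P (sym (cong f u)) p) (x , p)
      go refl = refl

    subst-counit : (P : B → Set c) {y y′ : B} (q : y′ ≡ y) (p : P y) →
                   _≡_ {A = Σ B P} (y′ , subst P (sym q) p) (y , p)
    subst-counit P refl p = refl

  -- The left inverse law transports along `counit e (f x)`. The adjoint law trades this for
  -- `cong f (unit e x)`, which path induction can eliminate.
  IsEquiv-Σ₁ : (P : B → Set c) → IsEquiv f →
               IsEquiv {X = Σ A (P ∘ f)} {Y = Σ B P} (λ (x , p) → f x , p)
  IsEquiv-Σ₁ P e = isEquiv _
    (λ (y , p) → inv e y , subst P (sym (counit e y)) p)
    (λ (x , p) → subst-unit P e x p _ (adjoint e x))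
    (λ (y , p) → subst-counit P (counit e y) p)

IsEquiv-Σ₂ : {A : Set a} {P : A → Set b} {Q : A → Set c} {f : ∀ x → P x → Q x} →
             (∀ x → IsEquiv (f x)) →
             IsEquiv {X = Σ A P} {Y = Σ A Q} (λ (x , p) → x , f x p)
IsEquiv-Σ₂ e = isEquiv _ (λ (x , q) → x , inv (e x) q)
  (λ (x , p) → cong (x ,_) (unit (e x) p))
  (λ (x , q) → cong (x ,_) (counit (e x) q))

-- Singletons are contractible, so a family of maps out of identity types is a
-- family of equivalences as soon as the total space of its target is one too.
IsEquiv-singleton : {A : Set a} {x : A} (R : A → Set b) (f : ∀ y → x ≡ y → R y) →
                    ((w : Σ A R) → (x , f x refl) ≡ w) → ∀ y → IsEquiv (f y)
IsEquiv-singleton {A = A} {x} R f contr y = isEquiv (f y)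
  (λ r → cong proj₁ (trans (sym (contr _)) (contr (y , r))))
  (λ { refl → cong (cong proj₁) (trans-symˡ (contr (x , f x refl))) })
  (λ r → transport (trans (sym (contr _)) (contr (y , r))))
  where
  transport : ∀ {w} (e : (x , f x refl) ≡ w) → f (proj₁ w) (cong proj₁ e) ≡ proj₂ w
  transport refl = refl

-- Homotopy induction and the universal properties of pushouts and of the reflection.

module _ {ℓ} (fe : FunExt ℓ) where

  -- By `counit`, every homotopy is `cong-app` of a path, so path induction suffices.
  ~-ind : {X : Set ℓ} {Y : X → Set ℓ} {f : ∀ x → Y x}
          (P : ∀ g → (∀ x → f x ≡ g x) → Set a) → P f (λ _ → refl) →
          ∀ g h → P g h
  ~-ind {f = f} P d g h = subst (P g) (counit (fe f g) h) (go (funext fe h))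
    where
    go : ∀ {g} (e : f ≡ g) → P g (cong-app e)
    go refl = d

  IsEquiv-Π : {X : Set ℓ} {P Q : X → Set ℓ} {f : ∀ x → P x → Q x} →
              (∀ x → IsEquiv (f x)) →
              IsEquiv {X = ∀ x → P x} {Y = ∀ x → Q x} (λ k x → f x (k x))
  IsEquiv-Π e = isEquiv _ (λ k x → inv (e x) (k x))
    (λ k → funext fe λ x → unit (e x) (k x))
    (λ k → funext fe λ x → counit (e x) (k x))

  IsEquiv-⊎ : {X Y : Set ℓ} {P : X ⊎ Y → Set ℓ} →
              IsEquiv {X = ∀ w → P w} {Y = (∀ x → P (inj₁ x)) × (∀ y → P (inj₂ y))}
                      (λ k → k ∘ inj₁ , k ∘ inj₂)
  IsEquiv-⊎ = isEquiv _ (λ { (l , r) (inj₁ x) → l x ; (l , r) (inj₂ y) → r y })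
    (λ k → funext fe λ { (inj₁ x) → refl ; (inj₂ y) → refl })
    (λ _ → refl)

  module _ {X Y Z : Set ℓ} {f : Z → X} {g : Z → Y} (po : PushoutOf f g) where
    open PushoutOf po

    methods : {P : Pushout → Set ℓ} → (∀ w → P w) → MethodsFor P
    methods k = k ∘ inl , k ∘ inr , λ z → dcong k (glue z)

    private
      -- The hypothesis on `m` has the shape of `elim-glue`, so the computation rules themselves
      -- supply a path of methods.
      methods-≡ : {P : Pushout → Set ℓ} {l l′ : ∀ x → P (inl x)} {r r′ : ∀ y → P (inr y)}
                  {m : ∀ z → subst P (glue z) (l (f z)) ≡ r (g z)}
                  {m′ : ∀ z → subst P (glue z) (l′ (f z)) ≡ r′ (g z)}
                  (L : ∀ x → l x ≡ l′ x) (R : ∀ y → r y ≡ r′ y) →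
                  (∀ z → trans (m z) (R (g z)) ≡ trans (cong (subst P (glue z)) (L (f z))) (m′ z)) →
                  _≡_ {A = MethodsFor P} (l , r , m) (l′ , r′ , m′)
      methods-≡ {P} {l} {l′} {r} {r′} {m} {m′} L R =
        ~-ind (λ l′ L → ∀ m′ →
                 (∀ z → trans (m z) (R (g z)) ≡
                        trans (cong (subst P (glue z)) (L (f z))) (m′ z)) →
                 (l , r , m) ≡ (l′ , r′ , m′))
          (~-ind (λ r′ R → ∀ m′ → (∀ z → trans (m z) (R (g z)) ≡ m′ z) →
                   (l , r , m) ≡ (l , r′ , m′))
            (λ m′ e → cong (λ m → l , r , m)
                        (funext fe λ z → trans (sym (trans-reflʳ (m z))) (e z)))
            r′ R)
          l′ L m′

      subst-≡ : {P : Pushout → Set ℓ} {k k′ : ∀ w → P w} {w w′ : Pushout} (p : w ≡ w′)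
                {d : k w ≡ k′ w} {d′ : k w′ ≡ k′ w′} →
                trans (dcong k p) d′ ≡ trans (cong (subst P p) d) (dcong k′ p) →
                subst (λ w → k w ≡ k′ w) p d ≡ d′
      subst-≡ refl {d} e = trans (sym (trans (trans-reflʳ _) (cong-id d))) (sym e)

    -- One inverse law is the computation rules; the other is an elimination into the family of
    -- paths from `elim P (methods k) w` to `k w`, whose glue case is again `elim-glue`.
    IsEquiv-methods : (P : Pushout → Set ℓ) → IsEquiv (methods {P})
    IsEquiv-methods P = isEquiv methods (elim P)
      (λ k → funext fe (elim (λ w → elim P (methods k) w ≡ k w)
        ( elim-inl P (methods k)
        , elim-inr P (methods k)
        , λ z → subst-≡ (glue z) (elim-glue P (methods k) z))))
      (λ M → methods-≡ (elim-inl P M) (elim-inr P M) (elim-glue P M))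

  private
    subst-const : {Q W : Set ℓ} {w w′ : Q} (p : w ≡ w′) (x : W) → x ≡ subst (λ _ → W) p x
    subst-const refl x = refl

    cong-dcong : {Q W : Set ℓ} (k : Q → W) {w w′ : Q} (p : w ≡ w′) →
                 trans (subst-const p (k w)) (dcong k p) ≡ cong k p
    cong-dcong k refl = refl

  -- Relative to a single target `W`, so that it also covers the reflection of a pushout tested
  -- against modal types.
  IsPushoutFor : {X Y Z Q : Set ℓ} (f : Z → X) (g : Z → Y) (inl : X → Q) (inr : Y → Q) →
                 (∀ z → inl (f z) ≡ inr (g z)) → Set ℓ → Set ℓ
  IsPushoutFor {X} {Y} {Z} {Q} f g inl inr glue W =
    IsEquiv {X = Q → W}
            {Y = Σ[ l ∈ (X → W) ] Σ[ r ∈ (Y → W) ] (∀ z → l (f z) ≡ r (g z))}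
            (λ k → k ∘ inl , k ∘ inr , λ z → cong k (glue z))

  isPushout : {X Y Z : Set ℓ} {f : Z → X} {g : Z → Y} (po : PushoutOf f g) (W : Set ℓ) →
              let open PushoutOf po in IsPushoutFor f g inl inr glue W
  isPushout po W = IsEquiv-resp-~
    (λ k → cong (λ m → _ , _ , m) (funext fe λ z → cong-dcong k (glue z)))
    (IsEquiv-∘ (IsEquiv-Σ₂ λ l → IsEquiv-Σ₂ λ r → IsEquiv-Π λ z →
                  IsEquiv-transˡ (subst-const (glue z) _))
               (IsEquiv-methods po _))
    where open PushoutOf po

  module _ (M : Modality ℓ) where
    open Modality M

    private
      -- Identity types of `○ X` are modal, so the two maps can be compared after `η X`, which is
      -- injective because `X` is modal.
      ∘η-injective : {P X : Set ℓ} → IsModal X → (k k′ : ○ P → X) →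
                     (∀ x → k (η P x) ≡ k′ (η P x)) → ∀ w → k w ≡ k′ w
      ∘η-injective {P} {X} mX k k′ e w =
        IsEquiv-injective mX
          (proj₁ (∘η-split P (λ w → (η X (k w) ≡ η X (k′ w)) , ≡-modal X _ _))
                 (λ x → cong (η X) (e x)) w)

    IsEquiv-∘η : {P X : Set ℓ} → IsModal X → IsEquiv (λ (k : ○ P → X) → k ∘ η P)
    IsEquiv-∘η {P} {X} mX = isEquiv _ (proj₁ split)
      (λ k → funext fe (∘η-injective mX _ k (cong-app (proj₂ split (k ∘ η P)))))
      (proj₂ split)
      where split = ∘η-split P (λ _ → X , mX)

    isPushout-○ : {X Y Z : Set ℓ} {f : Z → X} {g : Z → Y} (po : PushoutOf f g)
                  {W : Set ℓ} → IsModal W →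
                  let open PushoutOf po in
                  IsPushoutFor f g (η Pushout ∘ inl) (η Pushout ∘ inr)
                               (λ z → cong (η Pushout) (glue z)) W
    isPushout-○ po mW = IsEquiv-resp-~
      (λ k → cong (λ m → _ , _ , m) (funext fe λ z → cong-∘ (glue z)))
      (IsEquiv-∘ (isPushout po _) (IsEquiv-∘η mW))
      where open PushoutOf po

-- Attaching 1-cells and 2-cells.

push : ∀ {ℓ} {C Q X : Set ℓ} {ι : C → Q} (k : Q → X) {x y : C} (p q : x ≡ y) →
       cong ι p ≡ cong ι q → cong (k ∘ ι) p ≡ cong (k ∘ ι) q
push k p q e = trans (cong-∘ p) (trans (cong (cong k) e) (sym (cong-∘ q)))

module _ {ℓ} (fe : FunExt ℓ) where

  -- Such a pushout glues a cone over each `φ n`, with apex `inl n`. Two points as `B` give 1-cells,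
  -- a circle gives 2-cells.
  cone-attachment :
    {B C N Q : Set ℓ} {φ : N → B → C} {inl : N → Q} {inr : C → Q}
    {glue : ∀ ((n , z) : N × B) → inl n ≡ inr (φ n z)} {X : Set ℓ} →
    IsPushoutFor fe proj₁ (λ (n , z) → φ n z) inl inr glue X →
    IsEquiv {X = Q → X}
            {Y = Σ[ c ∈ (C → X) ] (∀ n → Σ[ r ∈ X ] (∀ z → r ≡ c (φ n z)))}
            (λ k → k ∘ inr , λ n → k (inl n) , λ z → cong k (glue (n , z)))
  cone-attachment e = IsEquiv-∘
    (isEquiv (λ (l , c , m) → c , λ n → l n , λ z → m (n , z))
             (λ (c , m) → (λ n → proj₁ (m n)) , c , λ (n , z) → proj₂ (m n) z)
             (λ _ → refl) (λ _ → refl))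
    e

  private
    -- Contracting the apex along its `false` leg leaves one path between the two ends.
    IsEquiv-cone-Bool : {X : Set ℓ} {y : Lift ℓ Bool → X} →
      IsEquiv {X = Σ[ r ∈ X ] (∀ z → r ≡ y z)}
              (λ (r , m) → trans (sym (m (lift false))) (m (lift true)))
    IsEquiv-cone-Bool {X} {y} = IsEquiv-∘ {g = to} to-equiv
      (IsEquiv-Σ₂ λ r → isEquiv (λ m → m (lift false) , m (lift true))
        (λ { (p , q) (lift false) → p ; (p , q) (lift true) → q })
        (λ m → funext fe λ { (lift false) → refl ; (lift true) → refl })
        (λ _ → refl))
      where
      to : Σ[ r ∈ X ] (r ≡ y (lift false)) × (r ≡ y (lift true)) → y (lift false) ≡ y (lift true)
      to (r , p , q) = trans (sym p) q
      to-equiv : IsEquiv to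
      to-equiv = isEquiv to (λ q → y (lift false) , refl , q)
        (λ { (r , refl , q) → refl }) (λ _ → refl)

    cong-trans-sym : {X Y : Set ℓ} (k : X → Y) {x y z : X} (p : x ≡ y) (q : x ≡ z) →
                     trans (sym (cong k p)) (cong k q) ≡ cong k (trans (sym p) q)
    cong-trans-sym k refl q = refl

  attach-1-cells : Pushouts ℓ → {D N : Set ℓ} (u v : N → D) →
    Σ[ C ∈ Set ℓ ] Σ[ ι ∈ (D → C) ] Σ[ e ∈ (∀ n → ι (u n) ≡ ι (v n)) ]
      ((X : Set ℓ) → IsEquiv {X = C → X} {Y = Σ[ d ∈ (D → X) ] (∀ n → d (u n) ≡ d (v n))}
                             (λ k → k ∘ ι , λ n → cong k (e n)))
  attach-1-cells po {D} {N} u v =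
    P.Pushout , P.inr , (λ n → trans (sym (P.glue (n , lift false))) (P.glue (n , lift true))) ,
    λ X → IsEquiv-resp-~
      (λ k → cong (_ ,_) (funext fe λ n → cong-trans-sym k (P.glue (n , lift false)) _))
      (IsEquiv-∘ (IsEquiv-Σ₂ λ d → IsEquiv-Π fe λ n → IsEquiv-cone-Bool)
                 (cone-attachment (isPushout fe pushout X)))
    where
    ends : N → Lift ℓ Bool → D
    ends n (lift b) = if b then v n else u n
    pushout = po {X = N} {Y = D} {Z = N × Lift ℓ Bool} proj₁ (λ (n , z) → ends n z)
    module P = PushoutOf pushout

  private
    module _ {X : Set ℓ} where

      triangle-cancel : {r x y : X} (m : r ≡ x) {p q : x ≡ y} {m′ : r ≡ y} →
                        trans m p ≡ m′ → trans m q ≡ m′ → p ≡ q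
      triangle-cancel m s t = trans-injectiveʳ m (trans s (sym t))

      -- Contracting `r` along `m`, and `m′` along the second triangle, leaves only the first
      -- triangle, which is then a 2-path from `p` to `q`.
      IsEquiv-triangle-cancel : {x y : X} {p q : x ≡ y} →
        IsEquiv {X = Σ[ r ∈ X ] Σ[ m ∈ r ≡ x ] Σ[ m′ ∈ r ≡ y ] (trans m p ≡ m′) × (trans m q ≡ m′)}
                {Y = p ≡ q}
                (λ (r , m , m′ , s , t) → triangle-cancel m s t)
      IsEquiv-triangle-cancel {x} {p = p} {q} = isEquiv _
        (λ e → x , refl , q , e , refl)
        (λ { (r , refl , m′ , s , refl) → cong (λ s → _ , _ , _ , s , refl) (trans-reflʳ s) })
        trans-reflʳ

    module _ {S C X : Set ℓ} (φ : S → C) (c : C → X) where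

      side : {r : X} (m : ∀ z → r ≡ c (φ z)) {i j : S} (g : i ≡ j) →
             trans (m i) (cong c (cong φ g)) ≡ m j
      side m refl = trans-reflʳ _

      subst-side : {r : X} {i j : S} (g : i ≡ j) (m : r ≡ c (φ i)) →
                   trans m (cong c (cong φ g)) ≡ subst (λ z → r ≡ c (φ z)) g m
      subst-side refl m = trans-reflʳ m

      -- Circle elimination provides `dcong m g`; this rewrites it as the naturality triangle
      -- `side`.
      side-dcong : {r : X} (m : ∀ z → r ≡ c (φ z)) {i j : S} (g : i ≡ j) →
                   trans (subst-side g (m i)) (dcong m g) ≡ side m g
      side-dcong m refl = trans-reflʳ _

    module _ {C Q X : Set ℓ} {ι : C → Q} (k : Q → X) {x y : C} where

      push-triangle : {r : Q} (m : r ≡ ι x) (p : x ≡ y) →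
                      trans (cong k m) (cong (k ∘ ι) p) ≡ cong k (trans m (cong ι p))
      push-triangle m p = trans (cong (trans (cong k m)) (cong-∘ p)) (trans-cong m)

    -- `α` and `β` are kept arbitrary so that path induction applies to them; they are later taken
    -- to be `cong-∘`.
    push-cancel : {Q X : Set ℓ} (k : Q → X) {r x y : Q} (m : r ≡ x) {m′ : r ≡ y} {p q : x ≡ y}
                  {p′ q′ : k x ≡ k y} (α : p′ ≡ cong k p) (β : q′ ≡ cong k q)
                  (s : trans m p ≡ m′) (t : trans m q ≡ m′) →
                  triangle-cancel (cong k m)
                    (trans (trans (cong (trans (cong k m)) α) (trans-cong m)) (cong (cong k) s))
                    (trans (trans (cong (trans (cong k m)) β) (trans-cong m)) (cong (cong k) t)) ≡
                  trans α (trans (cong (cong k) (triangle-cancel m s t)) (sym β))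
    push-cancel k refl refl refl refl t = go t
      where
      go : ∀ {p q} (t : q ≡ p) →
           trans-injectiveʳ refl (sym (cong (cong k) t)) ≡
           trans (cong (cong k) (sym t)) refl
      go refl = refl

    push-side : {S C Q X : Set ℓ} (φ : S → C) (ι : C → Q) (k : Q → X) {r : Q}
                (m : ∀ z → r ≡ ι (φ z)) {i j : S} (g : i ≡ j) →
                side φ (k ∘ ι) (λ z → cong k (m z)) g ≡
                trans (push-triangle k (m i) (cong φ g)) (cong (cong k) (side φ ι m g))
    push-side φ ι k m {i} refl = go (m i)
      where
      go : ∀ {r x} (p : r ≡ x) → trans-reflʳ (cong k p) ≡
           trans (trans-cong p) (cong (cong k) (trans-reflʳ p))
      go refl = refl

  -- Two points and two paths: a map from this circle to C is a pair of parallel paths.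
  module Circle (po : Pushouts ℓ) where

    circle = po {X = ⊤ {ℓ}} {Y = ⊤ {ℓ}} {Z = Lift ℓ Bool} _ _
    open PushoutOf circle public renaming (Pushout to S¹)

    north south : S¹
    north = inl tt
    south = inr tt

    left right : north ≡ south
    left  = glue (lift false)
    right = glue (lift true)

    -- Over `left` and over `right` the cone gives triangles with the same two legs; cancelling the
    -- leg at `north` fills the circle.
    cone-2-cell : {C X : Set ℓ} (φ : S¹ → C) (c : C → X) →
                  Σ[ r ∈ X ] (∀ z → r ≡ c (φ z)) → cong c (cong φ left) ≡ cong c (cong φ right)
    cone-2-cell φ c (r , m) = triangle-cancel (m north) (side φ c m left) (side φ c m right)

    -- The dependent universal property of the circle splits the legs into two paths and two
    -- triangles, to which `IsEquiv-triangle-cancel` applies.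
    IsEquiv-cone-2-cell : {C X : Set ℓ} (φ : S¹ → C) (c : C → X) → IsEquiv (cone-2-cell φ c)
    IsEquiv-cone-2-cell {C} {X} φ c = IsEquiv-resp-~
      (λ (r , m) → cong₂ (triangle-cancel (m north)) (side-dcong φ c m left) (side-dcong φ c m right))
      (IsEquiv-∘ IsEquiv-triangle-cancel
        (IsEquiv-Σ₂ {f = λ r m → _} λ r → IsEquiv-∘ (isEquiv
            (λ (l , r , m) → l tt , r tt ,
               trans (subst-side φ c left (l tt)) (m (lift false)) ,
               trans (subst-side φ c right (l tt)) (m (lift true)))
            (λ (l , r , m , m′) → (λ _ → l) , (λ _ → r) ,
               λ { (lift false) → trans (sym (subst-side φ c left l)) m
                 ; (lift true)  → trans (sym (subst-side φ c right l)) m′ })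
            (λ (l , r , m) → cong (λ m → _ , _ , m) (funext fe
               λ { (lift false) → cancel-sym (subst-side φ c left (l tt)) (m (lift false))
                 ; (lift true)  → cancel-sym (subst-side φ c right (l tt)) (m (lift true)) }))
            (λ (l , r , m , m′) → cong₂ (λ m m′ → _ , _ , m , m′)
               (cancel (subst-side φ c left l) m) (cancel (subst-side φ c right l) m′)))
          (IsEquiv-methods fe circle (λ z → r ≡ c (φ z)))))
      where
      cancel-sym : {A : Set ℓ} {x y z : A} (p : x ≡ y) (q : y ≡ z) → trans (sym p) (trans p q) ≡ q
      cancel-sym refl q = refl
      cancel : {A : Set ℓ} {x y z : A} (p : x ≡ y) (q : x ≡ z) → trans p (trans (sym p) q) ≡ q
      cancel refl q = refl

    -- Naturality of filling: it identifies the 2-cells induced by a map `k` out of the attachment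
    -- with the images of the attached ones.
    push-cone-2-cell : {C Q X : Set ℓ} (φ : S¹ → C) (ι : C → Q) (k : Q → X) {r : Q}
      (m : ∀ z → r ≡ ι (φ z)) →
      cone-2-cell φ (k ∘ ι) (k r , λ z → cong k (m z)) ≡
      push k (cong φ left) (cong φ right) (cone-2-cell φ ι (r , m))
    push-cone-2-cell φ ι k m = trans
      (cong₂ (triangle-cancel (cong k (m north))) (push-side φ ι k m left) (push-side φ ι k m right))
      (push-cancel k (m north) (cong-∘ (cong φ left)) (cong-∘ (cong φ right))
                   (side φ ι m left) (side φ ι m right))

    Bigon : Set ℓ → Set ℓ
    Bigon C = Σ[ x ∈ C ] Σ[ y ∈ C ] (x ≡ y) × (x ≡ y)

    bigon : {C : Set ℓ} → (S¹ → C) → Bigon C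
    bigon φ = φ north , φ south , cong φ left , cong φ right

    bigon-section : {C : Set ℓ} → HasSection (bigon {C})
    bigon-section {C} = (λ β → inv circle-rec (data′ β)) ,
      λ β → cong (λ (l , r , m) → l tt , r tt , m (lift false) , m (lift true))
                 (counit circle-rec (data′ β))
      where
      circle-rec = isPushout fe circle C
      data′ : Bigon C → Σ[ l ∈ (⊤ → C) ] Σ[ r ∈ (⊤ → C) ] (Lift ℓ Bool → l tt ≡ r tt)
      data′ (x , y , p , q) = (λ _ → x) , (λ _ → y) , λ (lift b) → if b then q else p

  -- Named as a family over the boundary paths so that it can be transported along identifications
  -- of boundaries.
  Attach-2-cells : Modality ℓ → {C N : Set ℓ} {u v : N → C} (p q : ∀ n → u n ≡ v n) → Set _
  Attach-2-cells M {C} p q =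
    Σ[ Q ∈ Set ℓ ] IsModal Q × (Σ[ ι ∈ (C → Q) ] Σ[ e ∈ (∀ n → cong ι (p n) ≡ cong ι (q n)) ]
      ((X : Set ℓ) → IsModal X →
       IsEquiv {X = Q → X} {Y = Σ[ c ∈ (C → X) ] (∀ n → cong c (p n) ≡ cong c (q n))}
               (λ k → k ∘ ι , λ n → push k (p n) (q n) (e n))))
    where open Modality M

  attach-2-cells : Pushouts ℓ → (M : Modality ℓ) {C N : Set ℓ} {u v : N → C}
                   (p q : ∀ n → u n ≡ v n) → Attach-2-cells M p q
  attach-2-cells po M {C} {N} {u} {v} p q =
    -- Circle recursion computes only up to a path, so the discs are attached along the circle maps
    -- chosen by `bigon-section`, and the result is transported to the given boundaries.
    subst (λ (β : N → Bigon C) → Attach-2-cells M (λ n → proj₁ (proj₂ (proj₂ (β n))))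
                                                  (λ n → proj₂ (proj₂ (proj₂ (β n)))))
      (funext fe λ n → proj₂ bigon-section (u n , v n , p n , q n))
      (attach-discs (λ n → proj₁ bigon-section (u n , v n , p n , q n)))
    where
    open Circle po
    open Modality M
    attach-discs : (φ : N → S¹ → C) →
                   Attach-2-cells M (λ n → cong (φ n) left) (λ n → cong (φ n) right)
    attach-discs φ =
      ○ P.Pushout , ○-modal _ , η _ ∘ P.inr ,
      (λ n → cone-2-cell (φ n) (η _ ∘ P.inr) (η _ (P.inl n) , λ z → cong (η _) (P.glue (n , z)))) ,
      λ X mX → IsEquiv-resp-~
        (λ k → cong (_ ,_) (funext fe λ n → push-cone-2-cell (φ n) _ k _))
        (IsEquiv-∘ (IsEquiv-Σ₂ λ c → IsEquiv-Π fe λ n → IsEquiv-cone-2-cell (φ n) c)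
                   (cone-attachment (isPushout-○ fe M pushout mX)))
      where
      pushout = po {X = N} {Y = C} {Z = N × S¹} proj₁ (λ (n , z) → φ n z)
      module P = PushoutOf pushout

-- Calculus of coherence squares.

Square : ∀ {ℓ} {G C : Set ℓ} (r : G → C) {y y′ : G} {w z : C} (φ : y ≡ y′)
         (σ′ : r y′ ≡ z) (h : r y ≡ w) (σ : w ≡ z) → Set ℓ
Square r φ σ′ h σ = trans (cong r φ) σ′ ≡ trans h σ

module _ {ℓ} {G C : Set ℓ} (r : G → C) {y y′ : G} {w z : C} (φ : y ≡ y′) where

  module _ (σ′ : r y′ ≡ z) (h : r y ≡ w) (σ : w ≡ z) where

    -- The input `e` is the datum carried by an attached 2-cell. Taking it to be `cong (cong k)` of
    -- a square gives the action of `k` on squares.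
    split : {X : Set ℓ} (k : C → X) → cong k (trans (cong r φ) σ′) ≡ cong k (trans h σ) →
            Square (k ∘ r) φ (cong k σ′) (cong k h) (cong k σ)
    split k e = trans (trans (cong (λ p → trans p (cong k σ′)) (cong-∘ φ)) (trans-cong (cong r φ)))
                      (trans e (sym (trans-cong h)))

    IsEquiv-split : {X : Set ℓ} (k : C → X) → IsEquiv (split k)
    IsEquiv-split k =
      IsEquiv-trans (trans (cong (λ p → trans p (cong k σ′)) (cong-∘ φ)) (trans-cong (cong r φ)))
                    (sym (trans-cong h))

    paste : {z′ : C} → Square r φ σ′ h σ → (p : z ≡ z′) → Square r φ (trans σ′ p) h (trans σ p)
    paste c p = trans (sym (trans-assoc (cong r φ)))
                      (trans (cong (λ q → trans q p) c) (trans-assoc h))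

  Square-~ : {σ′ σ′₁ : r y′ ≡ z} {h h₁ : r y ≡ w} {σ σ₁ : w ≡ z} →
             σ′ ≡ σ′₁ → h ≡ h₁ → σ ≡ σ₁ → Square r φ σ′ h σ → Square r φ σ′₁ h₁ σ₁ → Set ℓ
  Square-~ τ′ η τ c c₁ = trans c (cong₂ trans η τ) ≡ trans (cong (trans (cong r φ)) τ′) c₁

paste-refl : ∀ {ℓ} {G C : Set ℓ} (r : G → C) {y y′ : G} {w z : C} (φ : y ≡ y′)
             (σ′ : r y′ ≡ z) (h : r y ≡ w) (σ : w ≡ z) (c : Square r φ σ′ h σ) →
             Square-~ r φ (trans-reflʳ σ′) refl (trans-reflʳ σ) (paste r φ σ′ h σ c refl) c
paste-refl r refl refl refl σ refl = refl

-- Defs keeps the coherence behind the coslice's assoc private; assoc-square restates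
-- it, and ≡⇒~-assoc below recovers it by homotopy induction.
module _ {ℓ} {G C X : Set ℓ} (k : C → X) where

  assoc-square : (r : G → C) {y y′ : G} {z : C} {x : X} (φ : y ≡ y′) (σ′ : r y′ ≡ z) (p : k z ≡ x) →
                 trans (cong (k ∘ r) φ) (trans (cong k σ′) p) ≡
                 trans (cong k (trans (cong r φ) σ′)) p
  assoc-square r refl σ′ p = refl

  cong-trans-assoc : {y w z : C} {x : X} (h : y ≡ w) (σ : w ≡ z) (p : k z ≡ x) →
                     trans (cong k (trans h σ)) p ≡ trans (cong k h) (trans (cong k σ) p)
  cong-trans-assoc refl σ p = refl

  whisker : {y z w : C} {x : X} {q : y ≡ z} (h : y ≡ w) (σ : w ≡ z) → q ≡ trans h σ →
            (p : k z ≡ x) →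
            trans (cong k q) p ≡ trans (cong k h) (trans (cong k σ) p)
  whisker h σ c p = trans (cong (λ q → trans (cong k q) p) c) (cong-trans-assoc h σ p)

  -- Matches postcomposition in the coslice, an associator followed by a whiskering, with the action
  -- of `k` on squares followed by a change of pointing.
  assoc-whisker : (r : G → C) {y y′ : G} {w z : C} {x : X} (φ : y ≡ y′) (σ′ : r y′ ≡ z)
                  (h : r y ≡ w) (σ : w ≡ z) (c : Square r φ σ′ h σ) (p : k z ≡ x) →
                  trans (assoc-square r φ σ′ p) (whisker h σ c p) ≡
                  paste (k ∘ r) φ (cong k σ′) (cong k h) (cong k σ)
                        (split r φ σ′ h σ k (cong (cong k) c)) p
  assoc-whisker r refl refl refl σ refl p = refl

-- Splitting for `k ∘ ι` agrees with splitting for `ι` and then applying `k`, up to `cong-∘` on the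
-- edges.
split-push : ∀ {ℓ} {G C Q X : Set ℓ} (r : G → C) (ι : C → Q) (k : Q → X)
             {y y′ : G} {w z : C} (φ : y ≡ y′) (σ′ : r y′ ≡ z) (h : r y ≡ w) (σ : w ≡ z)
             (κ : cong ι (trans (cong r φ) σ′) ≡ cong ι (trans h σ)) →
             Square-~ (k ∘ ι ∘ r) φ (cong-∘ σ′) (cong-∘ h) (cong-∘ σ)
               (split r φ σ′ h σ (k ∘ ι) (push k (trans (cong r φ) σ′) (trans h σ) κ))
               (split (ι ∘ r) φ (cong ι σ′) (cong ι h) (cong ι σ) k
                 (cong (cong k) (split r φ σ′ h σ ι κ)))
-- Here `σ` has become a loop and cannot be eliminated; `go` frees the endpoint `cong ι σ` of `κ`
-- and the path `cong-∘ σ` instead.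
split-push r ι k {y = y} refl refl refl σ κ = go κ (cong-∘ σ)
  where
  go : ∀ {q : ι (r y) ≡ ι (r y)} (κ : refl ≡ q)
       {q′ : k (ι (r y)) ≡ k (ι (r y))} (α : q′ ≡ cong k q) →
       trans (trans (trans (cong (cong k) κ) (sym α)) refl) (cong₂ trans refl α) ≡
       trans (cong (cong k) (trans κ refl)) refl
  go refl refl = refl

-- Cocones under a diagram of pointed maps, as families of paths and squares.

module Unbundled {ℓ} (fe : FunExt ℓ) (A : Set ℓ) {V E : Set ℓ} (src tgt : E → V)
  (F : V → Set ℓ) (f : ∀ i → A → F i) (D : ∀ e → F (src e) → F (tgt e))
  (φ : ∀ e a → D e (f (src e) a) ≡ f (tgt e) a) where

  module _ {X : Set ℓ} (s : ∀ i → F i → X) where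

    Pointing : (A → X) → Set ℓ
    Pointing t = ((i , a) : V × A) → s i (f i a) ≡ t a

    Gluing : Set ℓ
    Gluing = ((e , x) : Σ[ e ∈ E ] F (src e)) → s (tgt e) (D e x) ≡ s (src e) x

    -- The composite of `φ e a` and `σ` is the pointing path of `s (tgt e)` after `D e` in the
    -- coslice, so the square says that gluing respects the points.
    Coherence : {t : A → X} → Pointing t → Gluing → Set ℓ
    Coherence σ h = ((e , a) : E × A) →
      Square (s (tgt e)) (φ e a) (σ (tgt e , a)) (h (e , f (src e) a)) (σ (src e , a))

  -- The data seen by 0-cells and 1-cells alone; the map `t` varies, being the restriction to the
  -- 0-cells from `A`.
  Skeleton : Set ℓ → Set ℓ
  Skeleton X = Σ[ t ∈ (A → X) ] Σ[ s ∈ (∀ i → F i → X) ] Pointing s t × Gluing s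

  ACocone : {X : Set ℓ} → (A → X) → Set ℓ
  ACocone {X} t =
    Σ[ s ∈ (∀ i → F i → X) ] Σ[ σ ∈ Pointing s t ] Σ[ h ∈ Gluing s ] Coherence s σ h

  ACocone-≡ : {X : Set ℓ} {t : A → X} {s : ∀ i → F i → X} {σ σ₁ : Pointing s t} {h h₁ : Gluing s}
              {c : Coherence s σ h} {c₁ : Coherence s σ₁ h₁}
              (τ : ∀ n → σ n ≡ σ₁ n) (η : ∀ n → h n ≡ h₁ n) →
              (∀ ((e , a) : E × A) →
                Square-~ (s (tgt e)) (φ e a) (τ (tgt e , a)) (η (e , f (src e) a)) (τ (src e , a))
                         (c (e , a)) (c₁ (e , a))) →
              _≡_ {A = ACocone t} (s , σ , h , c) (s , σ₁ , h₁ , c₁)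
  ACocone-≡ {t = t} {s} {σ} {σ₁} {h} {h₁} {c} {c₁} τ η =
    ~-ind fe
      (λ σ₁ τ → (c₁ : Coherence s σ₁ h₁) → Compatible τ η c₁ →
        (s , σ , h , c) ≡ (s , σ₁ , h₁ , c₁))
      (~-ind fe
        (λ h₁ η → (c₁ : Coherence s σ h₁) → Compatible (λ _ → refl) η c₁ →
          (s , σ , h , c) ≡ (s , σ , h₁ , c₁))
        (λ c₁ e → cong (λ c → s , σ , h , c)
                    (funext fe λ n → trans (sym (trans-reflʳ (c n))) (e n)))
        h₁ η)
      σ₁ τ c₁
    where
    Compatible : {σ₁ : Pointing s t} {h₁ : Gluing s} →
                 (∀ n → σ n ≡ σ₁ n) → (∀ n → h n ≡ h₁ n) → Coherence s σ₁ h₁ → Set ℓ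
    Compatible τ η c₁ = ((e , a) : E × A) →
      Square-~ (s (tgt e)) (φ e a) (τ (tgt e , a)) (η (e , f (src e) a)) (τ (src e , a))
               (c (e , a)) (c₁ (e , a))

  postmap : {X Y : Set ℓ} {t : A → X} (k : X → Y) → ACocone t → ACocone (k ∘ t)
  postmap k (s , σ , h , c) =
    (λ i x → k (s i x)) , (λ n → cong k (σ n)) , (λ n → cong k (h n)) ,
    λ (e , a) → split (s (tgt e)) (φ e a) (σ (tgt e , a)) (h (e , f (src e) a)) (σ (src e , a)) k
                      (cong (cong k) (c (e , a)))

  -- A coslice morphism `(k , p)` acts on cocones by `postmap k` followed by `repoint` along `p`.
  repoint : {X : Set ℓ} {t t₁ : A → X} → ACocone t → (∀ a → t a ≡ t₁ a) → ACocone t₁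
  repoint (s , σ , h , c) p =
    s , (λ (i , a) → trans (σ (i , a)) (p a)) , h ,
    λ (e , a) → paste (s (tgt e)) (φ e a) (σ (tgt e , a)) (h (e , f (src e) a)) (σ (src e , a))
                      (c (e , a)) (p a)

  repoint-refl : {X : Set ℓ} {t : A → X} (K : ACocone t) → repoint K (λ _ → refl) ≡ K
  repoint-refl (s , σ , h , c) = ACocone-≡ (λ n → trans-reflʳ (σ n)) (λ _ → refl)
    (λ (e , a) → paste-refl (s (tgt e)) (φ e a) _ _ _ (c (e , a)))

  RepointedSkeleton : {X : Set ℓ} → (A → X) → Skeleton X → Set ℓ
  RepointedSkeleton t (t₀ , s , σ , h) = (∀ a → t₀ a ≡ t a) × Coherence s σ h

  -- The pairs of a map `t₀` and a homotopy from it to `t` form a contractible type, so the pair can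
  -- be absorbed.
  IsEquiv-repoint : {X : Set ℓ} (t : A → X) →
    IsEquiv {X = Σ (Skeleton X) (RepointedSkeleton t)} {Y = ACocone t}
            (λ ((t₀ , s , σ , h) , p , c) → repoint (s , σ , h , c) p)
  IsEquiv-repoint {X} t = isEquiv _ from
    (λ ((t₀ , s , σ , h) , p , c) → from-repoint (s , σ , h , c) t p)
    repoint-refl
    where
    from : {t : A → X} → ACocone t → Σ (Skeleton X) (RepointedSkeleton t)
    from {t} (s , σ , h , c) = (t , s , σ , h) , (λ _ → refl) , c
    from-repoint : {t₀ : A → X} (K@(s , σ , h , c) : ACocone t₀)
                   (t : A → X) (p : ∀ a → t₀ a ≡ t a) →
                   from (repoint K p) ≡ ((t₀ , s , σ , h) , p , c)
    from-repoint {t₀} K@(s , σ , h , c) = ~-ind fe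
      (λ t p → from (repoint K p) ≡ ((t₀ , s , σ , h) , p , c))
      (cong from (repoint-refl K))

  -- The colimit as a reflected cell complex, and its universal property.

  module Colimit (po : Pushouts ℓ) (M : Modality ℓ) where
    open Modality M

    private
      -- Oriented so that the 1-cells over the two summands are exactly a `Pointing` and a `Gluing`.
      u v : (V × A) ⊎ (Σ[ e ∈ E ] F (src e)) → A ⊎ Σ V F
      u (inj₁ (i , a)) = inj₂ (i , f i a)
      u (inj₂ (e , x)) = inj₂ (tgt e , D e x)
      v (inj₁ (i , a)) = inj₁ a
      v (inj₂ (e , x)) = inj₂ (src e , x)

      C : Set ℓ
      C = proj₁ (attach-1-cells fe po u v)

      ι₁ : A ⊎ Σ V F → C
      ι₁ = proj₁ (proj₂ (attach-1-cells fe po u v))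

      edge : ∀ n → ι₁ (u n) ≡ ι₁ (v n)
      edge = proj₁ (proj₂ (proj₂ (attach-1-cells fe po u v)))

      t₁ : A → C
      t₁ = ι₁ ∘ inj₁

      r₁ : ∀ i → F i → C
      r₁ i x = ι₁ (inj₂ (i , x))

      σ₁ : Pointing r₁ t₁
      σ₁ = edge ∘ inj₁

      h₁ : Gluing r₁
      h₁ = edge ∘ inj₂

      restrict : {X : Set ℓ} → (C → X) → Skeleton X
      restrict k =
        k ∘ t₁ , (λ i x → k (r₁ i x)) , (λ n → cong k (σ₁ n)) , (λ n → cong k (h₁ n))

      IsEquiv-restrict : {X : Set ℓ} → IsEquiv (restrict {X})
      IsEquiv-restrict {X} = IsEquiv-∘ reshape (proj₂ (proj₂ (proj₂ (attach-1-cells fe po u v))) X)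
        where
        reshape : IsEquiv {X = Σ[ d ∈ (A ⊎ Σ V F → X) ] (∀ n → d (u n) ≡ d (v n))} {Y = Skeleton X}
                          (λ (d , e) → d ∘ inj₁ , (λ i x → d (inj₂ (i , x))) , e ∘ inj₁ , e ∘ inj₂)
        reshape = IsEquiv-∘
          (isEquiv (λ ((t , s) , σ , h) → t , (λ i x → s (i , x)) , σ , h)
                   (λ (t , s , σ , h) → (t , λ (i , x) → s i x) , σ , h)
                   (λ _ → refl) (λ _ → refl))
          (IsEquiv-∘
            (IsEquiv-Σ₁ (λ (t , s) → Pointing (λ i x → s (i , x)) t × Gluing (λ i x → s (i , x)))
                        (IsEquiv-⊎ fe))
            (IsEquiv-Σ₂ λ d → IsEquiv-⊎ fe))

      -- The two ways around each coherence square, hence the boundaries of the 2-cells.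
      p q : ((e , a) : E × A) → r₁ (tgt e) (D e (f (src e) a)) ≡ t₁ a
      p (e , a) = trans (cong (r₁ (tgt e)) (φ e a)) (σ₁ (tgt e , a))
      q (e , a) = trans (h₁ (e , f (src e) a)) (σ₁ (src e , a))

      discs : Attach-2-cells fe M p q
      discs = attach-2-cells fe po M p q

    Q : Set ℓ
    Q = proj₁ discs

    Q-modal : IsModal Q
    Q-modal = proj₁ (proj₂ discs)

    private
      ι : C → Q
      ι = proj₁ (proj₂ (proj₂ discs))

      κ : ∀ n → cong ι (p n) ≡ cong ι (q n)
      κ = proj₁ (proj₂ (proj₂ (proj₂ discs)))

      splits : {X : Set ℓ} (c : C → X) → (∀ n → cong c (p n) ≡ cong c (q n)) →
               Coherence (λ i x → c (r₁ i x)) (λ n → cong c (σ₁ n)) (λ n → cong c (h₁ n))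
      splits c ε (e , a) =
        split (r₁ (tgt e)) (φ e a) (σ₁ (tgt e , a)) (h₁ (e , f (src e) a)) (σ₁ (src e , a)) c
              (ε (e , a))

      IsEquiv-splits : {X : Set ℓ} (c : C → X) → IsEquiv (splits c)
      IsEquiv-splits c = IsEquiv-Π fe λ (e , a) → IsEquiv-split (r₁ (tgt e)) (φ e a) _ _ _ c

    base : A → Q
    base = ι ∘ t₁

    cocone : ACocone base
    cocone = (λ i x → ι (r₁ i x)) , (λ n → cong ι (σ₁ n)) , (λ n → cong ι (h₁ n)) , splits ι κ

    universal : {X : Set ℓ} → IsModal X → (t : A → X) →
                IsEquiv {X = Σ[ k ∈ (Q → X) ] (∀ a → k (base a) ≡ t a)} {Y = ACocone t}
                        (λ (k , π) → repoint (postmap k cocone) π)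
    universal {X} mX t = IsEquiv-resp-~
      (λ (k , π) → cong (λ K → repoint K π)
        (ACocone-≡ (λ n → cong-∘ (σ₁ n)) (λ n → cong-∘ (h₁ n))
          (λ (e , a) → split-push (r₁ (tgt e)) ι k (φ e a) _ _ _ (κ (e , a)))))
      -- From the innermost map outwards: a map on `Q` becomes a map on `C` with 2-paths, these
      -- become squares, the map on `C` becomes a skeleton, and the homotopy to `t` is absorbed.
      -- `split-push` above compares the result with postcomposition.
      (IsEquiv-∘ (IsEquiv-repoint t)
        (IsEquiv-∘ (IsEquiv-Σ₁ (RepointedSkeleton t) IsEquiv-restrict)
          (IsEquiv-∘ (isEquiv (λ ((c , ε) , π) → c , π , ε) (λ (c , π , ε) → (c , ε) , π)
                              (λ _ → refl) (λ _ → refl))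
            (IsEquiv-∘ (IsEquiv-Σ₁ (λ (c , _) → ∀ a → c (t₁ a) ≡ t a)
                                   (IsEquiv-Σ₂ IsEquiv-splits))
              (IsEquiv-Σ₁ (λ (c , _) → ∀ a → c (t₁ a) ≡ t a)
                          (proj₂ (proj₂ (proj₂ (proj₂ discs))) X mX))))))

-- Paths between coslice morphisms as pointed homotopies.

module _ {ℓ} (fe : FunExt ℓ) (A : Set ℓ) where
  open WildCategory (Coslice fe A) using (_⊚_; assoc)

  module _ {S T : CosliceOb fe A} where

    Hom-~ : CosliceHom fe A S T → CosliceHom fe A S T → Set ℓ
    Hom-~ (k , p) (l , q) =
      Σ[ h ∈ (∀ x → k x ≡ l x) ] (∀ a → p a ≡ trans (h (proj₂ S a)) (q a))

    ≡⇒~ : {u v : CosliceHom fe A S T} → u ≡ v → Hom-~ u v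
    ≡⇒~ refl = (λ _ → refl) , (λ _ → refl)

    -- Homotopy induction on `h` and then on `c` contracts the total space of `Hom-~ u`.
    IsEquiv-≡⇒~ : (u v : CosliceHom fe A S T) → IsEquiv (≡⇒~ {u} {v})
    IsEquiv-≡⇒~ u@(k , p) = IsEquiv-singleton (Hom-~ u) (λ v → ≡⇒~) contr
      where
      contr : (w : Σ (CosliceHom fe A S T) (Hom-~ u)) → (u , ≡⇒~ refl) ≡ w
      contr ((l , q) , h , c) =
        ~-ind fe (λ l h → ∀ q (c : ∀ a → p a ≡ trans (h (proj₂ S a)) (q a)) →
                    (u , ≡⇒~ refl) ≡ ((l , q) , h , c))
          (~-ind fe (λ q c → (u , ≡⇒~ refl) ≡ ((k , q) , (λ _ → refl) , c)) refl)
          l h q c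

    -- The associator of the coslice is a path of this form; `counit` of the strong form of funext
    -- recovers its homotopy.
    ≡⇒~-cong : {k : proj₁ S → proj₁ T} {p q : ∀ a → k (proj₂ S a) ≡ proj₂ T a}
               (e : ∀ a → p a ≡ q a) →
               ≡⇒~ {k , p} {k , q} (cong (k ,_) (funext fe e)) ≡ ((λ _ → refl) , e)
    ≡⇒~-cong {k} {p} {q} e = trans (go (funext fe e)) (cong ((λ _ → refl) ,_) (counit (fe p q) e))
      where
      go : ∀ {q} (e : p ≡ q) → ≡⇒~ {k , p} {k , q} (cong (k ,_) e) ≡ ((λ _ → refl) , cong-app e)
      go refl = refl

  ≡⇒~-assoc : {S T U W : CosliceOb fe A} (k : CosliceHom fe A U W) (r : CosliceHom fe A T U)
              (d : CosliceHom fe A S T) →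
    ≡⇒~ (assoc {S} {T} {U} {W} k r d) ≡
    ((λ _ → refl) , λ a → assoc-square (proj₁ k) (proj₁ r) (proj₂ d a) (proj₂ r a) (proj₂ k a))
  ≡⇒~-assoc {S} {T , t} {U} {W} k (r , σ) (d , φ) =
    -- Once `φ` is reflexivity, the coherence of the associator and `assoc-square` both reduce to
    -- `refl`.
    ~-ind fe
      (λ t φ → (σ : ∀ a → r (t a) ≡ proj₂ U a) →
        ≡⇒~ (assoc {S} {T , t} {U} {W} k (r , σ) (d , φ)) ≡
        ((λ _ → refl) , λ a → assoc-square (proj₁ k) r (φ a) (σ a) (proj₂ k a)))
      (λ σ → ≡⇒~-cong (λ _ → refl))
      t φ σ

  -- With `e` and its unpacking `(h , c)` both variable, each is eliminated; the associator that
  -- remains is handled by `assoc-whisker`.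
  ≡⇒~-postcompose : {S T U W : CosliceOb fe A} (k : CosliceHom fe A U W) (r : CosliceHom fe A T U)
    (d : CosliceHom fe A S T) {v : CosliceHom fe A S U}
    (e : _⊚_ {S} {T} {U} r d ≡ v) {h : ∀ x → proj₁ r (proj₁ d x) ≡ proj₁ v x}
    {c : ∀ a → trans (cong (proj₁ r) (proj₂ d a)) (proj₂ r a) ≡ trans (h (proj₂ S a)) (proj₂ v a)} →
    ≡⇒~ e ≡ (h , c) →
    ≡⇒~ (trans (assoc {S} {T} {U} {W} k r d) (cong (_⊚_ {S} {U} {W} k) e)) ≡
    ( (λ x → cong (proj₁ k) (h x))
    , λ a → paste (proj₁ k ∘ proj₁ r) (proj₂ d a) (cong (proj₁ k) (proj₂ r a))
                  (cong (proj₁ k) (h (proj₂ S a))) (cong (proj₁ k) (proj₂ v a))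
                  (split (proj₁ r) (proj₂ d a) (proj₂ r a) (h (proj₂ S a)) (proj₂ v a) (proj₁ k)
                         (cong (cong (proj₁ k)) (c a)))
                  (proj₂ k a))
  ≡⇒~-postcompose {S} {T} {U} {W} k r d refl refl =
    trans (cong ≡⇒~ (trans-reflʳ (assoc {S} {T} {U} {W} k r d)))
      (trans (≡⇒~-assoc {S} {T} {U} {W} k r d)
        (cong ((λ _ → refl) ,_) (funext fe λ a →
          trans (sym (trans-reflʳ _))
            (assoc-whisker (proj₁ k) (proj₁ r) (proj₂ d a) (proj₂ r a) refl _ refl (proj₂ k a)))))

-- Transfer to cocones in the wild category of modal `A`-types.

module _ {ℓ} (fe : FunExt ℓ) (A : Set ℓ) (M : Modality ℓ) {Γ : Graph ℓ}
         (F : Diagram (ModalCoslice fe A M) Γ) where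
  open Modality M
  open Graph Γ
  open Diagram F

  private
    S : Vertex → CosliceOb fe A
    S i = proj₁ (obj i)

    src tgt : Σ[ i ∈ Vertex ] Σ[ j ∈ Vertex ] Edge i j → Vertex
    src (i , j , g) = i
    tgt (i , j , g) = j

  open Unbundled fe A src tgt (λ i → proj₁ (S i)) (λ i → proj₂ (S i))
                 (λ (i , j , g) → proj₁ (map g)) (λ (i , j , g) → proj₂ (map g)) public

  -- Halfway between `CoconeOn` and `ACocone`: paths of morphisms are already homotopies, but the
  -- data are still grouped by morphism.
  Bundled : {X : Set ℓ} (t : A → X) → Set ℓ
  Bundled {X} t = Σ[ s ∈ (∀ i → CosliceHom fe A (S i) (X , t)) ]
    (∀ i j (g : Edge i j) →
      Hom-~ fe A {S i} {X , t}
        (WildCategory._⊚_ (Coslice fe A) {S i} {S j} {X , t} (s j) (map g)) (s i))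

  module _ {X : Set ℓ} {t : A → X} where

    unbundle : Bundled t → ACocone t
    unbundle (s , H) =
      (λ i → proj₁ (s i)) , (λ (i , a) → proj₂ (s i) a) ,
      (λ ((i , j , g) , x) → proj₁ (H i j g) x) , (λ ((i , j , g) , a) → proj₂ (H i j g) a)

    bundle : ACocone t → Bundled t
    bundle (s , σ , h , c) =
      (λ i → s i , λ a → σ (i , a)) ,
      λ i j g → (λ x → h ((i , j , g) , x)) , λ a → c ((i , j , g) , a)

    IsEquiv-unbundle : IsEquiv unbundle
    IsEquiv-unbundle = isEquiv unbundle bundle (λ _ → refl) (λ _ → refl)

    coconeOn : (mX : IsModal X) → ACocone t → CoconeOn F ((X , t) , mX)
    coconeOn mX K =
      proj₁ (bundle K) ,
      λ i j g → inv (IsEquiv-≡⇒~ fe A {S i} {X , t} _ _) (proj₂ (bundle K) i j g)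

    unbundleOn : (mX : IsModal X) → CoconeOn F ((X , t) , mX) → ACocone t
    unbundleOn mX (s , H) = unbundle (s , λ i j g → ≡⇒~ fe A {S i} {X , t} (H i j g))

    IsEquiv-unbundleOn : (mX : IsModal X) → IsEquiv (unbundleOn mX)
    IsEquiv-unbundleOn mX = IsEquiv-∘ IsEquiv-unbundle
      (IsEquiv-Σ₂ λ s → IsEquiv-Π fe λ i → IsEquiv-Π fe λ j → IsEquiv-Π fe λ g →
        IsEquiv-≡⇒~ fe A {S i} {X , t} _ _)

  module _ {Q : Set ℓ} {b : A → Q} (mQ : IsModal Q) (K : ACocone b)
           {X : Set ℓ} {t : A → X} (mX : IsModal X) where

    unbundleOn-postcompose : (k : CosliceHom fe A (Q , b) (X , t)) →
      repoint (postmap (proj₁ k) K) (proj₂ k) ≡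
      unbundleOn mX (postcompose F (((Q , b) , mQ) , coconeOn mQ K) ((X , t) , mX) k)
    unbundleOn-postcompose k =
      cong (λ H → unbundle ((λ i → WildCategory._⊚_ (Coslice fe A) {S i} {Q , b} {X , t} k (r i)) , H))
        (funext fe λ i → funext fe λ j → funext fe λ g →
          sym (≡⇒~-postcompose fe A {S i} {S j} {Q , b} {X , t} k (r j) (map g) {r i} _
                 -- `coconeOn` builds its paths with `inv`, so unpacking them returns the homotopies
                 -- of `K`.
                 (counit (IsEquiv-≡⇒~ fe A {S i} {Q , b} _ _) (proj₂ (bundle K) i j g))))
      where r = proj₁ (bundle K)

    -- Unbundling after `postcompose` is the given equivalence up to homotopy, and unbundling is
    -- itself an equivalence, so it cancels.
    IsEquiv-postcompose :
      IsEquiv {X = CosliceHom fe A (Q , b) (X , t)} {Y = ACocone t}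
              (λ (k , p) → repoint (postmap k K) p) →
      IsEquiv (postcompose F (((Q , b) , mQ) , coconeOn mQ K) ((X , t) , mX))
    IsEquiv-postcompose e =
      IsEquiv-cancelˡ (IsEquiv-unbundleOn mX) (IsEquiv-resp-~ unbundleOn-postcompose e)

corollary7p3 : (ℓ : Level) (fe : FunExt ℓ) (po : Pushouts ℓ) (M : Modality ℓ) (A : Set ℓ) →
    HasAllColimits (ModalCoslice fe A M)
corollary7p3 ℓ fe po M A Γ F =
  (((Q , base) , Q-modal) , coconeOn fe A M F Q-modal cocone) ,
  λ ((X , t) , mX) → IsEquiv-postcompose fe A M F Q-modal cocone mX (universal mX t)
  where
  open Colimit fe A M F po M
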